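{- Let $q$ be a prime power and $n \geq 1$ an integer. If the graph $\Gamma_{l-i}(M_n(F_q))$ has a cycle, then its girth is $g(\Gamma_{l-i}(M_n(F_q))) = 3$.
   Context: $F_q$ is the finite field with $q$ elements and $M_n(F_q)$ is the ring of all $n\times n$ matrices over $F_q$. For $X \in M_n(F_q)$, $[X] = \{AX : A \in M_n(F_q)\}$ is the left ideal generated by $X$. The undirected left-ideal relation graph $\Gamma_{l-i}(M_n(F_q))$ is the simple graph with vertex set $M_n(F_q)$ in which two distinct vertices $X, Y$ are adjacent if and only if $[X] \subset [Y]$ or $[Y] \subset [X]$, where $\subset$ denotes proper containment. The girth $g(\Gamma)$ is the length of a shortest cycle of $\Gamma$. -}

module Defs where

open import Algebra.Bundles using (CommutativeRing; Ring)
open import Data.Fin.Base using (Fin; zero; suc; toℕ)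
open import Data.Nat.Base as ℕ using (ℕ; zero; suc; _^_)
open import Data.Nat.Primality using (Prime)
open import Data.Product.Base using (_×_; _,_; ∃-syntax)
open import Data.Sum.Base as Sum using (_⊎_; swap)
open import Data.Vec.Functional using (Vector)
import Data.Vec.Functional.Relation.Binary.Pointwise.Properties as Pointwise
open import Function.Base using (_∘_)
open import Function.Bundles using (Inverse)
open import Function.Definitions using (Injective)
open import Level using (Level; _⊔_) renaming (suc to lsuc)
open import Relation.Binary.Bundles using (Setoid)
open import Relation.Binary.Core using (Rel)
open import Relation.Binary.Definitions using (Symmetric; Irreflexive; _Respects₂_)
open import Relation.Binary.PropositionalEquality.Core using (_≡_)
open import Relation.Binary.PropositionalEquality.Properties using () renaming (setoid to ≡-setoid)
open import Relation.Nullary.Negation.Core using (¬_)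
open import Relation.Unary using (Pred; _⊂_; _⊆_)

IsPrimePower : ℕ → Set
IsPrimePower q = ∃[ p ] ∃[ k ] Prime p × k ℕ.≥ 1 × q ≡ p ^ k

record Field (c ℓ : Level) : Set (lsuc (c ⊔ ℓ)) where
  field
    commutativeRing : CommutativeRing c ℓ

  open CommutativeRing commutativeRing public

  field
    0≉1     : ¬ (0# ≈ 1#)
    inverse : ∀ x → ¬ (x ≈ 0#) → ∃[ y ] x * y ≈ 1#

HasCardinality : ∀ {c ℓ} → Setoid c ℓ → ℕ → Set (c ⊔ ℓ)
HasCardinality S q = Inverse S (≡-setoid (Fin q))

record SimpleGraph (v ℓ e : Level) : Set (lsuc (v ⊔ ℓ ⊔ e)) where
  field
    vertices : Setoid v ℓ

  open Setoid vertices public using (_≈_) renaming (Carrier to Vertex)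

  field
    Adjacent  : Rel Vertex e
    symmetric : Symmetric Adjacent
    loopless  : Irreflexive _≈_ Adjacent
    respects  : Adjacent Respects₂ _≈_

module _ {v ℓ e} (Γ : SimpleGraph v ℓ e) where
  open SimpleGraph Γ

  record Cycle (k : ℕ) : Set (v ⊔ ℓ ⊔ e) where
    field
      3≤k      : 3 ℕ.≤ k
      vertex   : Fin k → Vertex
      distinct : Injective _≡_ _≈_ vertex
      step     : ∀ i j → suc (toℕ i) ≡ toℕ j → Adjacent (vertex i) (vertex j)
      close    : ∀ i j → suc (toℕ i) ≡ k → toℕ j ≡ 0 → Adjacent (vertex i) (vertex j)

  HasCycle : Set (v ⊔ ℓ ⊔ e)
  HasCycle = ∃[ k ] Cycle k

  -- The girth is a relation, since whether a graph has a cycle is not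
  -- decidable in general; no number is the girth of an acyclic graph.
  record HasGirth (g : ℕ) : Set (v ⊔ ℓ ⊔ e) where
    field
      attained : Cycle g
      shortest : ∀ k → Cycle k → g ℕ.≤ k

module _ {c ℓ} (R : Ring c ℓ) where
  open Ring R

  leftIdeal : Carrier → Pred Carrier (c ⊔ ℓ)
  leftIdeal x y = ∃[ a ] y ≈ a * x

  private
    leftIdeal-resp : ∀ {x y} → x ≈ y → leftIdeal x ⊆ leftIdeal y
    leftIdeal-resp x≈y (a , z≈ax) = a , trans z≈ax (*-congˡ x≈y)

    _⊏_ : Rel Carrier (c ⊔ ℓ)
    x ⊏ y = leftIdeal x ⊂ leftIdeal y

    ⊏-resp : ∀ {x x′ y y′} → x ≈ x′ → y ≈ y′ → x ⊏ y → x′ ⊏ y′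
    ⊏-resp p q (x⊆y , y⊈x) =
      (λ z → leftIdeal-resp q (x⊆y (leftIdeal-resp (sym p) z))) ,
      (λ y′⊆x′ → y⊈x (λ z → leftIdeal-resp (sym p) (y′⊆x′ (leftIdeal-resp q z))))

  LeftIdealAdjacent : Rel Carrier (c ⊔ ℓ)
  LeftIdealAdjacent x y =
    ¬ (x ≈ y) × (leftIdeal x ⊂ leftIdeal y ⊎ leftIdeal y ⊂ leftIdeal x)

  leftIdealRelationGraph : SimpleGraph c ℓ (c ⊔ ℓ)
  leftIdealRelationGraph = record
    { vertices  = setoid
    ; Adjacent  = LeftIdealAdjacent
    ; symmetric = λ (x≉y , r) → x≉y ∘ sym , swap r
    ; loopless  = λ x≈y (x≉y , _) → x≉y x≈y
    ; respects  =
        (λ p (x≉y , r) → (λ q → x≉y (trans q (sym p))) , Sum.map (⊏-resp refl p) (⊏-resp p refl) r) ,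
        (λ p (x≉y , r) → (λ q → x≉y (trans p q)) , Sum.map (⊏-resp p refl) (⊏-resp refl p) r)
    }

module _ {c ℓ} (R : Ring c ℓ) (n : ℕ) where
  open Ring R
  open import Algebra.Properties.Semiring.Sum semiring
  open import Relation.Binary.Reasoning.Setoid setoid

  Matrix : Set c
  Matrix = Vector (Vector Carrier n) n

  δ : ∀ {m} → Fin m → Fin m → Carrier
  δ zero    zero    = 1#
  δ zero    (suc _) = 0#
  δ (suc _) zero    = 0#
  δ (suc i) (suc j) = δ i j

  mul : Matrix → Matrix → Matrix
  mul A B i j = ∑[ k < n ] (A i k * B k j)

  private
    sum-≈0 : ∀ {m} (f : Vector Carrier m) → (∀ i → f i ≈ 0#) → sum f ≈ 0#
    sum-≈0 {m} f f≈0 = trans (sum-cong-≋ f≈0) (sum-replicate-zero m)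

    sum-δˡ : ∀ {m} (i : Fin m) (f : Vector Carrier m) → ∑[ k < m ] (δ i k * f k) ≈ f i
    sum-δˡ zero    f = trans (+-cong (*-identityˡ _) (sum-≈0 (λ k → 0# * f (suc k)) (λ k → zeroˡ _))) (+-identityʳ _)
    sum-δˡ (suc i) f = trans (+-cong (zeroˡ _) (sum-δˡ i (f ∘ suc))) (+-identityˡ _)

    sum-δʳ : ∀ {m} (j : Fin m) (f : Vector Carrier m) → ∑[ k < m ] (f k * δ k j) ≈ f j
    sum-δʳ zero    f = trans (+-cong (*-identityʳ _) (sum-≈0 (λ k → f (suc k) * 0#) (λ k → zeroʳ _))) (+-identityʳ _)
    sum-δʳ (suc j) f = trans (+-cong (zeroʳ _) (sum-δʳ j (f ∘ suc))) (+-identityˡ _)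

    mul-assoc : ∀ A B C i j → mul (mul A B) C i j ≈ mul A (mul B C) i j
    mul-assoc A B C i j = begin
      ∑[ k < n ] (∑[ l < n ] (A i l * B l k) * C k j)
        ≈⟨ sum-cong-≋ (λ k → *-distribʳ-sum (C k j) (λ l → A i l * B l k)) ⟩
      ∑[ k < n ] ∑[ l < n ] (A i l * B l k * C k j)
        ≈⟨ ∑-comm (λ k l → A i l * B l k * C k j) ⟩
      ∑[ l < n ] ∑[ k < n ] (A i l * B l k * C k j)
        ≈⟨ sum-cong-≋ (λ l → sum-cong-≋ (λ k → *-assoc (A i l) (B l k) (C k j))) ⟩
      ∑[ l < n ] ∑[ k < n ] (A i l * (B l k * C k j))
        ≈⟨ sum-cong-≋ (λ l → *-distribˡ-sum (A i l) (λ k → B l k * C k j)) ⟨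
      ∑[ l < n ] (A i l * ∑[ k < n ] (B l k * C k j)) ∎

  matrixRing : Ring c ℓ
  matrixRing = record
    { Carrier = Matrix
    ; _≈_     = λ A B → ∀ i j → A i j ≈ B i j
    ; _+_     = λ A B i j → A i j + B i j
    ; _*_     = mul
    ; -_      = λ A i j → - A i j
    ; 0#      = λ _ _ → 0#
    ; 1#      = δ
    ; isRing  = record
      { +-isAbelianGroup = record
        { isGroup = record
          { isMonoid = record
            { isSemigroup = record
              { isMagma = record
                { isEquivalence = Pointwise.isEquivalence (Pointwise.isEquivalence isEquivalence n) n
                ; ∙-cong        = λ p q i j → +-cong (p i j) (q i j)
                }
              ; assoc = λ A B C i j → +-assoc (A i j) (B i j) (C i j)
              }
            ; identity = (λ A i j → +-identityˡ (A i j)) , (λ A i j → +-identityʳ (A i j))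
            }
          ; inverse = (λ A i j → -‿inverseˡ (A i j)) , (λ A i j → -‿inverseʳ (A i j))
          ; ⁻¹-cong = λ p i j → -‿cong (p i j)
          }
        ; comm = λ A B i j → +-comm (A i j) (B i j)
        }
      ; *-cong     = λ p q i j → sum-cong-≋ (λ k → *-cong (p i k) (q k j))
      ; *-assoc    = mul-assoc
      ; *-identity = (λ A i j → sum-δˡ i (λ k → A k j)) , (λ A i j → sum-δʳ j (A i))
      ; distrib    =
          (λ A B C i j → trans (sum-cong-≋ (λ k → distribˡ (A i k) (B k j) (C k j)))
                               (∑-distrib-+ (λ k → A i k * B k j) (λ k → A i k * C k j))) ,
          (λ A B C i j → trans (sum-cong-≋ (λ k → distribʳ (A k j) (B i k) (C i k)))
                               (∑-distrib-+ (λ k → B i k * A k j) (λ k → C i k * A k j)))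
      }
    }

{-# OPTIONS --safe #-}

-- For n ≥ 2 the chain of left ideals [0] ⊂ [E₁₁] ⊂ [1] is a triangle.  For
-- n = 1 the only left ideals are [0] and [1], so 0 is an endpoint of every
-- edge and there is no cycle at all.
module Submission where

open import Defs
open import Algebra.Bundles using (Ring)
open import Algebra.Properties.Semiring.Sum using (sum-cong-≋; sum-replicate-zero)
open import Data.Empty using (⊥-elim)
open import Data.Fin.Base using (Fin; suc; fromℕ)
open import Data.Fin.Patterns using (0F; 1F; 2F)
open import Data.Fin.Properties using (toℕ-fromℕ)
open import Data.Nat using (ℕ; suc; _≥_; z≤n; s≤s)
open import Data.Product.Base using (_,_)
open import Data.Sum.Base using (inj₁; inj₂)
open import Relation.Binary.Bundles using (Setoid)
open import Relation.Binary.PropositionalEquality.Core as ≡ using (_≡_)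
open import Relation.Nullary.Negation.Core using (¬_)
open import Relation.Unary using (_⊂_; _⊆_)

-- Every `Cycle` has length at least 3 by definition, so it is enough to exhibit a triangle or to
-- refute the assumed cycle. A nonzero ring element with no left inverse generates a left ideal
-- strictly between `[0]` and `[1]`, and such a chain is a triangle; a singular matrix unit serves
-- when n ≥ 2. When n = 1 every nonzero matrix is invertible, all edges meet 0, and a star contains
-- no cycle.

module _ {v ℓ e} (Γ : SimpleGraph v ℓ e) where
  open SimpleGraph Γ
  open Setoid vertices using (sym; trans)

  triangle : ∀ {x y z} → Adjacent x y → Adjacent y z → Adjacent z x → Cycle Γ 3
  triangle {x} {y} {z} xy yz zx = record
    { 3≤k      = s≤s (s≤s (s≤s z≤n))
    ; vertex   = vertex
    ; distinct = λ {i} {j} → distinct i j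
    ; step     = λ { 0F 1F _ → xy ; 1F 2F _ → yz ; 0F 0F () ; 0F 2F () ; 1F 0F () ; 1F 1F ()
                   ; 2F 0F () ; 2F 1F () ; 2F 2F () }
    ; close    = λ { 2F 0F _ _ → zx ; 0F _ () _ ; 1F _ () _ ; 2F 1F _ () ; 2F 2F _ () }
    }
    where
    vertex : Fin 3 → Vertex
    vertex 0F = x
    vertex 1F = y
    vertex 2F = z

    distinct : ∀ i j → vertex i ≈ vertex j → i ≡ j
    distinct 0F 0F _ = ≡.refl
    distinct 1F 1F _ = ≡.refl
    distinct 2F 2F _ = ≡.refl
    distinct 0F 1F p = ⊥-elim (loopless p xy)
    distinct 1F 2F p = ⊥-elim (loopless p yz)
    distinct 2F 0F p = ⊥-elim (loopless p zx)
    distinct 1F 0F p = ⊥-elim (loopless (sym p) xy)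
    distinct 2F 1F p = ⊥-elim (loopless (sym p) yz)
    distinct 0F 2F p = ⊥-elim (loopless (sym p) zx)

  -- If `v₀` is not the centre `z`, both its neighbours on the cycle must be `z`, yet they are
  -- distinct. The double negation in `cover` avoids deciding `_≈_`, and it suffices because the
  -- goal is a contradiction.
  star-acyclic : ∀ z → (∀ {x y} → Adjacent x y → ¬ x ≈ z → ¬ ¬ y ≈ z) → ¬ HasCycle Γ
  star-acyclic z cover (suc (suc (suc m)) , C) =
    cover v₀~v₁ v₀≉z λ v₁≈z →
    cover (symmetric last~v₀) v₀≉z λ last≈z →
    1≢last (distinct (trans v₁≈z (sym last≈z)))
    where
    open Cycle C

    v₀~v₁ : Adjacent (vertex 0F) (vertex 1F)
    v₀~v₁ = step 0F 1F ≡.refl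

    last~v₀ : Adjacent (vertex (fromℕ (suc (suc m)))) (vertex 0F)
    last~v₀ = close _ 0F (≡.cong suc (toℕ-fromℕ _)) ≡.refl

    1≢last : ¬ 1F ≡ fromℕ (suc (suc m))
    1≢last ()

    0≢2 : ¬ _≡_ {A = Fin (suc (suc (suc m)))} 0F 2F
    0≢2 ()

    -- Were `v₀` the centre, the edge from `v₁` to `v₂` would miss it.
    v₀≉z : ¬ vertex 0F ≈ z
    v₀≉z v₀≈z = cover (step 1F 2F ≡.refl)
      (λ v₁≈z → loopless (trans v₀≈z (sym v₁≈z)) v₀~v₁)
      (λ v₂≈z → 0≢2 (distinct (trans v₀≈z (sym v₂≈z))))
  star-acyclic z cover (0 , record { 3≤k = () })
  star-acyclic z cover (1 , record { 3≤k = s≤s () })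
  star-acyclic z cover (2 , record { 3≤k = s≤s (s≤s ()) })

module _ {c ℓ} (R : Ring c ℓ) where
  open Ring R

  ∈⇒leftIdeal⊆ : ∀ {x y} → leftIdeal R y x → leftIdeal R x ⊆ leftIdeal R y
  ∈⇒leftIdeal⊆ (a , x≈ay) (b , z≈bx) =
    b * a , trans z≈bx (trans (*-congˡ x≈ay) (sym (*-assoc b a _)))

  self∈leftIdeal : ∀ x → leftIdeal R x x
  self∈leftIdeal x = 1# , sym (*-identityˡ x)

  leftIdeal-⊂ : ∀ {x y} → leftIdeal R y x → ¬ leftIdeal R x y → leftIdeal R x ⊂ leftIdeal R y
  leftIdeal-⊂ {y = y} x∈[y] y∉[x] = ∈⇒leftIdeal⊆ x∈[y] , λ [y]⊆[x] → y∉[x] ([y]⊆[x] (self∈leftIdeal y))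

  ∉⇒adjacent : ∀ {x y} → leftIdeal R y x → ¬ leftIdeal R x y → LeftIdealAdjacent R x y
  ∉⇒adjacent x∈[y] y∉[x] =
    (λ x≈y → y∉[x] (1# , trans (sym x≈y) (sym (*-identityˡ _)))) , inj₁ (leftIdeal-⊂ x∈[y] y∉[x])

  triangle-0-e-1 : ∀ e → ¬ e ≈ 0# → ¬ leftIdeal R e 1# → Cycle (leftIdealRelationGraph R) 3
  triangle-0-e-1 e e≉0 1∉[e] = triangle Γ
    (∉⇒adjacent (0∈ e) e∉[0])
    (∉⇒adjacent (∈1 e) 1∉[e])
    -- The closing edge is strict as well: `[0]` lies in `[e]`, which omits 1.
    (SimpleGraph.symmetric Γ (∉⇒adjacent (0∈ 1#) λ 1∈[0] → 1∉[e] (∈⇒leftIdeal⊆ (0∈ e) 1∈[0])))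
    where
    Γ = leftIdealRelationGraph R

    0∈ : ∀ x → leftIdeal R x 0#
    0∈ x = 0# , sym (zeroˡ x)

    ∈1 : ∀ x → leftIdeal R 1# x
    ∈1 x = x , sym (*-identityʳ x)

    e∉[0] : ¬ leftIdeal R 0# e
    e∉[0] (a , e≈a0) = e≉0 (trans e≈a0 (zeroʳ a))

  -- A nonzero element generates the whole ring, so the smaller ideal of any strict inclusion is
  -- generated by 0.
  divisionRing-acyclic : (∀ x → ¬ x ≈ 0# → leftIdeal R x 1#) → ¬ HasCycle (leftIdealRelationGraph R)
  divisionRing-acyclic inv = star-acyclic (leftIdealRelationGraph R) 0# λ
    { (_ , inj₁ (_ , [y]⊈[x])) x≉0 _   → [y]⊈[x] (everything x≉0)
    ; (_ , inj₂ (_ , [x]⊈[y])) _   y≉0 → [x]⊈[y] (everything y≉0)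
    }
    where
    everything : ∀ {x y} → ¬ x ≈ 0# → leftIdeal R y ⊆ leftIdeal R x
    everything {x} {y} x≉0 = ∈⇒leftIdeal⊆ (∈⇒leftIdeal⊆ (inv x x≉0) (y , sym (*-identityʳ y)))

module _ {c ℓ} (F : Field c ℓ) where
  open Field F

  nonzero-1×1-leftInvertible : let module M = Ring (matrixRing ring 1) in
    ∀ A → ¬ A M.≈ M.0# → leftIdeal (matrixRing ring 1) A M.1#
  nonzero-1×1-leftInvertible A A≉0 with inverse (A 0F 0F) (λ a≈0 → A≉0 λ { 0F 0F → a≈0 })
  -- The sole entry of the product is `b * A 0F 0F + 0#`, a one-term sum.
  ... | b , ab≈1 = (λ _ _ → b) , λ { 0F 0F → sym (trans (+-identityʳ _) (trans (*-comm b _) ab≈1)) }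

  module _ (n : ℕ) where
    private module M = Ring (matrixRing ring (suc (suc n)))

    E₁₁ : M.Carrier
    E₁₁ 0F      0F      = 1#
    E₁₁ 0F      (suc _) = 0#
    E₁₁ (suc _) _       = 0#

    E₁₁≉0 : ¬ E₁₁ M.≈ M.0#
    E₁₁≉0 E≈0 = 0≉1 (sym (E≈0 0F 0F))

    -- The second column of `E₁₁` vanishes, hence so does that of every left multiple, whereas the
    -- identity has a 1 there.
    1∉[E₁₁] : ¬ leftIdeal (matrixRing ring (suc (suc n))) E₁₁ M.1#
    1∉[E₁₁] (A , 1≈AE) = 0≉1 (sym (trans (1≈AE 1F 1F)
      (trans (sum-cong-≋ semiring column) (sum-replicate-zero semiring (suc (suc n))))))
      where
      column : ∀ k → A 1F k * E₁₁ k 1F ≈ 0#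
      column 0F      = zeroʳ _
      column (suc k) = zeroʳ _

theorem4p6 : ∀ {c ℓ} (q n : ℕ) → IsPrimePower q → n ≥ 1 →
    (F : Field c ℓ) → HasCardinality (Field.setoid F) q →
    HasCycle (leftIdealRelationGraph (matrixRing (Field.ring F) n)) →
    HasGirth (leftIdealRelationGraph (matrixRing (Field.ring F) n)) 3
theorem4p6 q 1 _ _ F _ cycle =
  ⊥-elim (divisionRing-acyclic (matrixRing (Field.ring F) 1) (nonzero-1×1-leftInvertible F) cycle)
theorem4p6 q (suc (suc n)) _ _ F _ _ = record
  { attained = triangle-0-e-1 (matrixRing (Field.ring F) (suc (suc n))) (E₁₁ F n) (E₁₁≉0 F n) (1∉[E₁₁] F n)
  ; shortest = λ _ → Cycle.3≤k
  }
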